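{- Let $G$ be a path of length $L>0$, regarded as a metric graph, and let $w\ge 0$ be an integer. For every graph $G_w$ obtained from $G$ by adding $w$ wormholes, $\mathrm{diam}(G_w)\ge L/(w+1)$, and there is a choice of $w$ wormholes for which $\mathrm{diam}(G_w)=L/(w+1)$.
   Context: A metric graph is a finite edge-weighted graph regarded as a metric space in which all points in the interior of each edge are included and each edge is locally isometric to an interval whose length is the edge weight; $\mathrm{diam}(G)=\max_{x,y\in G} d_G(x,y)$ over all points of $G$, where $d_G(x,y)$ is the minimum length of a path from $x$ to $y$. A path of length $L$ is an interval of length $L$. A wormhole is a pair of points of $G$ (arbitrary points, not necessarily vertices); adding a wormhole means identifying its two points, equivalently adding an edge of length zero between them. $G_w$ is the metric graph obtained after all the identifications. Different wormholes may share points. -}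

module Defs where

open import Level using (Level; _⊔_) renaming (suc to lsuc)
open import Data.Nat.Base using (ℕ)
open import Data.Fin.Base using (Fin; zero; suc)
open import Data.Product.Base using (∃; ∃₂; _×_; proj₁; proj₂)
open import Data.Vec.Functional using (Vector)
open import Relation.Nullary.Negation.Core using (¬_)
open import Relation.Unary using (Pred; Satisfiable)
open import Relation.Binary.Core using (Rel)
open import Relation.Binary.Bundles using (TotalOrder)
open import Relation.Binary.Structures using (IsDecTotalOrder)
open import Algebra.Core using (Op₁; Op₂)
open import Algebra.Bundles using (CommutativeRing)
open import Algebra.Structures using (IsCommutativeRing)
import Algebra.Construct.NaturalChoice.Max as Max
import Algebra.Definitions.RawMonoid as RawMonoid
import Relation.Binary.Construct.NonStrictToStrict as NonStrictToStrict

-- The real numbers, axiomatised as a Dedekind-complete ordered field; this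
-- determines them up to isomorphism.  The axioms are the classical ones: the
-- order is decidable and every inhabited bounded predicate has a supremum.
record Reals (c ℓ₁ ℓ₂ : Level) : Set (lsuc (c ⊔ ℓ₁ ⊔ ℓ₂)) where
  infix  8 _⁻¹
  infix  8 -_
  infixl 7 _*_ _/_
  infixl 6 _+_ _-_
  infix  4 _≈_ _≉_ _≤_
  field
    Carrier           : Set c
    _≈_               : Rel Carrier ℓ₁
    _≤_               : Rel Carrier ℓ₂
    _+_ _*_           : Op₂ Carrier
    -_                : Op₁ Carrier
    0# 1#             : Carrier
    -- Only meaningful away from 0#.
    _⁻¹               : Op₁ Carrier
    isCommutativeRing : IsCommutativeRing _≈_ _+_ _*_ -_ 0# 1#
    isDecTotalOrder   : IsDecTotalOrder _≈_ _≤_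

  _≉_ : Rel Carrier ℓ₁
  x ≉ y = ¬ (x ≈ y)

  IsUpperBound : Pred Carrier (c ⊔ ℓ₁ ⊔ ℓ₂) → Carrier → Set (c ⊔ ℓ₁ ⊔ ℓ₂)
  IsUpperBound S b = ∀ x → S x → x ≤ b

  field
    0≉1        : 0# ≉ 1#
    *-inverseʳ : ∀ x → x ≉ 0# → x * x ⁻¹ ≈ 1#
    +-monoˡ-≤  : ∀ z {x y} → x ≤ y → x + z ≤ y + z
    *-nonNeg   : ∀ {x y} → 0# ≤ x → 0# ≤ y → 0# ≤ x * y
    supremum   : (S : Pred Carrier (c ⊔ ℓ₁ ⊔ ℓ₂)) → Satisfiable S → ∃ (IsUpperBound S) →
                 ∃ λ s → IsUpperBound S s × (∀ b → IsUpperBound S b → s ≤ b)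

  open IsDecTotalOrder isDecTotalOrder public
    using (_≟_; _≤?_; isTotalOrder)

  commutativeRing : CommutativeRing c ℓ₁
  commutativeRing = record { isCommutativeRing = isCommutativeRing }

  totalOrder : TotalOrder c ℓ₁ ℓ₂
  totalOrder = record { isTotalOrder = isTotalOrder }

  open NonStrictToStrict _≈_ _≤_ public using (_<_)

  _-_ : Op₂ Carrier
  x - y = x + (- y)

  _/_ : Op₂ Carrier
  x / y = x * y ⁻¹

  ∣_∣ : Op₁ Carrier
  ∣ x ∣ = Max._⊔_ totalOrder x (- x)

  fromℕ : ℕ → Carrier
  fromℕ n = RawMonoid._×_ (CommutativeRing.+-rawMonoid commutativeRing) n 1#

module MetricGraphs {c ℓ₁ ℓ₂} (R : Reals c ℓ₁ ℓ₂) where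

  open Reals R

  -- Loops and multiple edges are allowed.
  record MetricGraph : Set (c ⊔ ℓ₁ ⊔ ℓ₂) where
    field
      #vertices #edges : ℕ
      source target    : Fin #edges → Fin #vertices
      weight           : Fin #edges → Carrier
      weight>0         : ∀ e → 0# < weight e

  module _ (G : MetricGraph) where

    open MetricGraph G

    data Point : Set (c ⊔ ℓ₁ ⊔ ℓ₂) where
      vertex   : Fin #vertices → Point
      interior : (e : Fin #edges) (t : Carrier) → 0# < t → t < weight e → Point

    -- `At e x t`: under the isometry of the edge e with [0, weight e], the
    -- point x of the closed edge has coordinate t.  The two ends of a loop
    -- give its vertex two coordinates.
    data At (e : Fin #edges) : Point → Carrier → Set (c ⊔ ℓ₁ ⊔ ℓ₂) where
      source-at   : At e (vertex (source e)) 0#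
      target-at   : At e (vertex (target e)) (weight e)
      interior-at : ∀ t 0<t t<w → At e (interior e t 0<t t<w) t

    Wormhole : Set (c ⊔ ℓ₁ ⊔ ℓ₂)
    Wormhole = Point × Point

  -- The metric graph G_w is given by G together with its w wormholes.  Its
  -- points are represented by points of G; the ends of a wormhole represent
  -- the same point, so moving between them has length zero.
  module _ (G : MetricGraph) {w : ℕ} (W : Vector (Wormhole G) w) where

    open MetricGraph G

    data Step : Point G → Point G → Carrier → Set (c ⊔ ℓ₁ ⊔ ℓ₂) where
      along    : ∀ e {x y s t} → At G e x s → At G e y t → Step x y ∣ s - t ∣
      forward  : ∀ i → Step (proj₁ (W i)) (proj₂ (W i)) 0#
      backward : ∀ i → Step (proj₂ (W i)) (proj₁ (W i)) 0#

    -- `Path x y ℓ`: a path in G_w from x to y of length ℓ.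
    data Path : Point G → Point G → Carrier → Set (c ⊔ ℓ₁ ⊔ ℓ₂) where
      []  : ∀ {x} → Path x x 0#
      _∷_ : ∀ {x y z a b} → Step x y a → Path y z b → Path x z (a + b)

    IsDistance : Point G → Point G → Carrier → Set (c ⊔ ℓ₁ ⊔ ℓ₂)
    IsDistance x y d = (∃ λ ℓ → Path x y ℓ × ℓ ≈ d) × (∀ ℓ → Path x y ℓ → d ≤ ℓ)

    IsDiameter : Carrier → Set (c ⊔ ℓ₁ ⊔ ℓ₂)
    IsDiameter D =
      (∀ x y → ∃ λ d → IsDistance x y d × d ≤ D) × (∃₂ λ x y → IsDistance x y D)

  pathGraph : (L : Carrier) → 0# < L → MetricGraph
  pathGraph L 0<L = record
    { #vertices = 2
    ; #edges    = 1
    ; source    = λ _ → zero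
    ; target    = λ _ → suc zero
    ; weight    = λ _ → L
    ; weight>0  = λ _ → 0<L
    }

{-# OPTIONS --safe #-}

-- Cut the path into w + 1 segments of length ℓ = L / (w + 1).
--
-- Lower bound: consider the continuous functions on the path that vanish at 0
-- and have a constant slope on each segment.  Taking equal values at the two
-- ends of every wormhole is a system of w homogeneous linear equations in the
-- w + 1 slopes, so it has a nonzero solution, which we scale so that the
-- largest modulus of a slope is 1.  The resulting function is 1-Lipschitz on
-- G_w and changes by ℓ across some segment, whose ends are therefore at
-- distance at least ℓ.
--
-- Sharpness: identify the midpoints of all w + 1 segments.  Every point is
-- within ℓ / 2 of this common point, and both ends of the path are exactly
-- ℓ / 2 away from it.
module Submission where

open import Defs
open import Algebra.Bundles using (CommutativeRing)
import Algebra.Construct.NaturalChoice.Max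
import Algebra.Construct.NaturalChoice.Min
import Algebra.Properties.AbelianGroup
import Algebra.Properties.CommutativeMonoid.Sum
import Algebra.Properties.Ring
import Algebra.Properties.Semiring.Mult
import Algebra.Properties.Semiring.Mult.TCOptimised
import Algebra.Properties.Semiring.Sum
import Algebra.Solver.Ring
open import Algebra.Solver.Ring.AlmostCommutativeRing using (fromCommutativeRing; _-Raw-AlmostCommutative⟶_)
open import Data.Fin.Base using (Fin; zero; suc; punchIn; punchOut; toℕ)
open import Data.Fin.Properties as Fin using (punchIn-punchOut; all?; ¬∀⟶∃¬; toℕ<n)
open import Data.Integer.Base using (0ℤ; 1ℤ)
open import Data.List.Base using (allFin)
import Data.List.Extrema
open import Data.List.Membership.Propositional.Properties using (∈-allFin)
import Data.List.Relation.Unary.All as All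
open import Data.Maybe.Base using (Maybe; just; nothing)
open import Data.Nat.Base as ℕ using (ℕ; zero; suc; z≤n; s≤s)
import Data.Nat.Properties as ℕ
open import Data.Product.Base using (∃; _×_; _,_; proj₁; proj₂)
open import Data.Sum.Base using (_⊎_; inj₁; inj₂; [_,_]′)
open import Data.Vec.Functional using (Vector; tail) renaming (_∷_ to _∷ᵛ_)
open import Relation.Binary.Bundles using (TotalOrder)
open import Relation.Binary.PropositionalEquality as ≡ using (_≡_)
import Relation.Binary.Reasoning.PartialOrder
import Relation.Binary.Reasoning.Setoid
open import Relation.Nullary using (yes; no)

-- The canonical homomorphism from the integers to a commutative ring.

-- The ring solver cancels terms only when equality of coefficients computes;
-- equality in R does not, so the coefficients are taken in ℤ.
module IntegerCoefficients {c ℓ} (R : CommutativeRing c ℓ) where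
  open import Data.Integer.Base as ℤ using (ℤ; +_; -[1+_]; _⊖_; _◃_; ∣_∣)
  import Data.Integer.Properties as ℤ
  open import Data.Sign.Base as Sign using (Sign)
  open CommutativeRing R
  open Algebra.Properties.Ring ring
  open Algebra.Properties.AbelianGroup +-abelianGroup using (⁻¹-∙-comm)
  open Algebra.Properties.Semiring.Mult.TCOptimised semiring renaming (_×_ to _·_)
  open Relation.Binary.Reasoning.Setoid setoid

  ⟦_⟧ : ℤ → Carrier
  ⟦ + n ⟧      = n · 1#
  ⟦ -[1+ n ] ⟧ = - (suc n · 1#)

  -- Integer multiplication is defined by multiplying signs and absolute values, so its
  -- compatibility with the ring is checked sign by sign.
  signed : Sign → Carrier → Carrier
  signed Sign.+ x = x
  signed Sign.- x = - x

  ⟦⟧-neg : ∀ i → ⟦ ℤ.- i ⟧ ≈ - ⟦ i ⟧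
  ⟦⟧-neg (+ zero)    = sym -0#≈0#
  ⟦⟧-neg (+ (suc n)) = refl
  ⟦⟧-neg -[1+ n ]    = sym (-‿involutive _)

  ⟦⟧-⊖ : ∀ m n → ⟦ m ⊖ n ⟧ ≈ m · 1# + - (n · 1#)
  ⟦⟧-⊖ zero zero = sym (-‿inverseʳ 0#)
  ⟦⟧-⊖ zero (suc n) = sym (+-identityˡ _)
  ⟦⟧-⊖ (suc m) zero = sym (trans (+-congˡ -0#≈0#) (+-identityʳ _))
  ⟦⟧-⊖ (suc m) (suc n) = begin
    ⟦ suc m ⊖ suc n ⟧                  ≡⟨ ≡.cong ⟦_⟧ (ℤ.[1+m]⊖[1+n]≡m⊖n m n) ⟩
    ⟦ m ⊖ n ⟧                          ≈⟨ ⟦⟧-⊖ m n ⟩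
    x + - y                            ≈⟨ +-congʳ (+-identityʳ x) ⟨
    x + 0# + - y                       ≈⟨ +-congʳ (+-congˡ (-‿inverseʳ 1#)) ⟨
    x + (1# + - 1#) + - y              ≈⟨ +-congʳ (+-assoc x 1# (- 1#)) ⟨
    x + 1# + - 1# + - y                ≈⟨ +-assoc (x + 1#) (- 1#) (- y) ⟩
    x + 1# + (- 1# + - y)              ≈⟨ +-cong (+-comm x 1#) (⁻¹-∙-comm 1# y) ⟩
    -- `suc m · 1#` does not unfold for a variable `m`, hence additivity with `1` as first summand.
    -- In exchange, `⟦ 1ℤ ⟧` computes to `1#`.
    1# + x + - (1# + y)                ≈⟨ +-cong (×-homo-+ 1# 1 m) (-‿cong (×-homo-+ 1# 1 n)) ⟨
    suc m · 1# + - (suc n · 1#)        ∎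
    where x = m · 1#
          y = n · 1#

  ⟦⟧-+ : ∀ i j → ⟦ i ℤ.+ j ⟧ ≈ ⟦ i ⟧ + ⟦ j ⟧
  ⟦⟧-+ (+ m) (+ n)           = ×-homo-+ 1# m n
  ⟦⟧-+ (+ m) -[1+ n ]        = ⟦⟧-⊖ m (suc n)
  ⟦⟧-+ -[1+ m ] (+ n)        = trans (⟦⟧-⊖ n (suc m)) (+-comm _ _)
  ⟦⟧-+ -[1+ m ] -[1+ n ] = begin
    ⟦ -[1+ m ] ℤ.+ -[1+ n ] ⟧             ≡⟨ ≡.cong ⟦_⟧ (ℤ.neg-distrib-+ (+ suc m) (+ suc n)) ⟨
    - ((suc m ℕ.+ suc n) · 1#)            ≈⟨ -‿cong (×-homo-+ 1# (suc m) (suc n)) ⟩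
    - (suc m · 1# + suc n · 1#)           ≈⟨ ⁻¹-∙-comm (suc m · 1#) (suc n · 1#) ⟨
    - (suc m · 1#) + - (suc n · 1#)       ∎

  ⟦⟧-◃ : ∀ s n → ⟦ s ◃ n ⟧ ≈ signed s (n · 1#)
  ⟦⟧-◃ Sign.+ zero    = refl
  ⟦⟧-◃ Sign.- zero    = sym -0#≈0#
  ⟦⟧-◃ Sign.+ (suc n) = refl
  ⟦⟧-◃ Sign.- (suc n) = refl

  signed-* : ∀ s t x y → signed (s Sign.* t) (x * y) ≈ signed s x * signed t y
  signed-* Sign.+ Sign.+ x y = refl
  signed-* Sign.+ Sign.- x y = -‿distribʳ-* x y
  signed-* Sign.- Sign.+ x y = -‿distribˡ-* x y
  signed-* Sign.- Sign.- x y = sym (begin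
    - x * - y      ≈⟨ -‿distribˡ-* x (- y) ⟨
    - (x * - y)    ≈⟨ -‿cong (-‿distribʳ-* x y) ⟨
    - - (x * y)    ≈⟨ -‿involutive (x * y) ⟩
    x * y          ∎)

  signed-cong : ∀ s {x y} → x ≈ y → signed s x ≈ signed s y
  signed-cong Sign.+ = λ p → p
  signed-cong Sign.- = -‿cong

  ⟦⟧-sign : ∀ i → signed (ℤ.sign i) (∣ i ∣ · 1#) ≈ ⟦ i ⟧
  ⟦⟧-sign (+ n)    = refl
  ⟦⟧-sign -[1+ n ] = refl

  ⟦⟧-* : ∀ i j → ⟦ i ℤ.* j ⟧ ≈ ⟦ i ⟧ * ⟦ j ⟧
  ⟦⟧-* i j = begin
    ⟦ s ◃ ∣ i ∣ ℕ.* ∣ j ∣ ⟧                                       ≈⟨ ⟦⟧-◃ s (∣ i ∣ ℕ.* ∣ j ∣) ⟩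
    signed s ((∣ i ∣ ℕ.* ∣ j ∣) · 1#)                             ≈⟨ signed-cong s (×1-homo-* ∣ i ∣ ∣ j ∣) ⟩
    signed s ((∣ i ∣ · 1#) * (∣ j ∣ · 1#))                        ≈⟨ signed-* (ℤ.sign i) (ℤ.sign j) _ _ ⟩
    signed (ℤ.sign i) (∣ i ∣ · 1#) * signed (ℤ.sign j) (∣ j ∣ · 1#) ≈⟨ *-cong (⟦⟧-sign i) (⟦⟧-sign j) ⟩
    ⟦ i ⟧ * ⟦ j ⟧                                                 ∎
    where s = ℤ.sign i Sign.* ℤ.sign j

  homomorphism : ℤ.+-*-rawRing -Raw-AlmostCommutative⟶ fromCommutativeRing R
  homomorphism = record
    { ⟦_⟧    = ⟦_⟧
    ; +-homo = ⟦⟧-+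
    ; *-homo = ⟦⟧-*
    ; -‿homo = ⟦⟧-neg
    ; 0-homo = refl
    ; 1-homo = refl
    }

  equal? : ∀ i j → Maybe (⟦ i ⟧ ≈ ⟦ j ⟧)
  equal? i j with i ℤ.≟ j
  ... | yes i≡j = just (reflexive (≡.cong ⟦_⟧ i≡j))
  ... | no  _   = nothing

  module Solver = Algebra.Solver.Ring ℤ.+-*-rawRing (fromCommutativeRing R) homomorphism equal?

-- Arithmetic and linear algebra over an ordered field.

module OrderedField {c ℓ₁ ℓ₂} (R : Reals c ℓ₁ ℓ₂) where
  open Reals R public
  open CommutativeRing commutativeRing public
    using (refl; sym; trans; reflexive; setoid; semiring; ring; +-commutativeMonoid;
           +-cong; +-congˡ; +-congʳ; *-cong; *-congˡ; *-congʳ; -‿cong; +-identityˡ; +-identityʳ;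
           *-identityˡ; *-identityʳ; *-comm; *-assoc; +-comm; zeroˡ; zeroʳ; -‿inverseʳ)
  open Algebra.Properties.Ring ring public using (-‿involutive; -0#≈0#; -1*x≈-x)
  open IntegerCoefficients.Solver commutativeRing public
    using (solve; _:=_; _:+_; _:*_; :-_; _:-_; con)
  open TotalOrder totalOrder public
    using (total; antisym; poset; ≤-respʳ-≈; ≤-respˡ-≈)
    renaming (refl to ≤-refl; trans to ≤-trans; reflexive to ≤-reflexive)
  open Algebra.Construct.NaturalChoice.Min totalOrder public
    using (_⊓_; x⊓y≤x; x⊓y≤y; ⊓-sel; ⊓-glb; ⊓-cong; ⊓-monoˡ-≤; x≤y⇒x⊓y≈x; x≤y⇒y⊓x≈x)
  open Algebra.Construct.NaturalChoice.Max totalOrder public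
    using (_⊔_; ⊔-sel; ⊔-lub; ⊔-cong; ⊔-monoˡ-≤; x≤y⇒x⊔y≈y; x≤y⇒y⊔x≈y; x≤x⊔y; x≤y⊔x)
  open Algebra.Properties.Semiring.Sum semiring public
    using (sum; *-distribˡ-sum; sum-cong-≋; sum-replicate-zero)
  open Algebra.Properties.CommutativeMonoid.Sum +-commutativeMonoid public using (∑-distrib-+)
  open Algebra.Properties.Semiring.Mult semiring public using (×-assoc-*; ×-congʳ) renaming (_×_ to _·_)
  module ≈-Reasoning = Relation.Binary.Reasoning.Setoid setoid
  module ≤-Reasoning = Relation.Binary.Reasoning.PartialOrder poset

  private variable
    a b d x y z : Carrier
    n : ℕ

  +-mono-≤ : a ≤ b → x ≤ y → a + x ≤ b + y
  +-mono-≤ {a} {b} {x} {y} a≤b x≤y = begin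
    a + x ≤⟨ +-monoˡ-≤ x a≤b ⟩
    b + x ≈⟨ +-comm b x ⟩
    x + b ≤⟨ +-monoˡ-≤ b x≤y ⟩
    y + b ≈⟨ +-comm y b ⟩
    b + y ∎
    where open ≤-Reasoning

  +-nonNeg : 0# ≤ x → 0# ≤ y → 0# ≤ x + y
  +-nonNeg 0≤x 0≤y = ≤-respˡ-≈ (+-identityʳ 0#) (+-mono-≤ 0≤x 0≤y)

  ≤⇒0≤- : x ≤ y → 0# ≤ y - x
  ≤⇒0≤- {x} {y} x≤y = ≤-respˡ-≈ (-‿inverseʳ x) (+-monoˡ-≤ (- x) x≤y)

  0≤-⇒≤ : 0# ≤ y - x → x ≤ y
  0≤-⇒≤ {y} {x} h = begin
    x          ≈⟨ +-identityˡ x ⟨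
    0# + x     ≤⟨ +-monoˡ-≤ x h ⟩
    y - x + x  ≈⟨ solve 2 (λ x y → y :- x :+ x := y) refl x y ⟩
    y          ∎
    where open ≤-Reasoning

  -- Reduces an inequality to a nonnegative quantity and a ring identity, which is left to the
  -- solver; `≤-by` does the same from a known inequality.
  ≤-from : 0# ≤ d → y - x ≈ d → x ≤ y
  ≤-from 0≤d eq = 0≤-⇒≤ (≤-respʳ-≈ (sym eq) 0≤d)

  ≤-by : a ≤ b → y - x ≈ b - a → x ≤ y
  ≤-by a≤b = ≤-from (≤⇒0≤- a≤b)

  neg-nonNeg : x ≤ 0# → 0# ≤ - x
  neg-nonNeg {x} x≤0 = ≤-by x≤0 (solve 1 (λ x → :- x :- con 0ℤ := con 0ℤ :- x) refl x)

  0≤1 : 0# ≤ 1#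
  0≤1 with total 0# 1#
  ... | inj₁ 0≤1 = 0≤1
  ... | inj₂ 1≤0 = ≤-respʳ-≈ (solve 0 (:- con 1ℤ :* :- con 1ℤ := con 1ℤ) refl)
                     (*-nonNeg (neg-nonNeg 1≤0) (neg-nonNeg 1≤0))

  *-monoʳ-≤ : 0# ≤ z → x ≤ y → x * z ≤ y * z
  *-monoʳ-≤ {z} {x} {y} 0≤z x≤y =
    ≤-from (*-nonNeg (≤⇒0≤- x≤y) 0≤z)
      (solve 3 (λ x y z → y :* z :- x :* z := (y :- x) :* z) refl x y z)

  *-nonZero : x ≉ 0# → y ≉ 0# → x * y ≉ 0#
  *-nonZero {x} {y} x≉0 y≉0 xy≈0 = y≉0 (begin
    y               ≈⟨ *-identityˡ y ⟨
    1# * y          ≈⟨ *-congʳ (*-inverseʳ x x≉0) ⟨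
    x * x ⁻¹ * y    ≈⟨ solve 3 (λ x x⁻¹ y → x :* x⁻¹ :* y := x :* y :* x⁻¹) refl x (x ⁻¹) y ⟩
    x * y * x ⁻¹    ≈⟨ *-congʳ xy≈0 ⟩
    0# * x ⁻¹       ≈⟨ zeroˡ (x ⁻¹) ⟩
    0#              ∎)
    where open ≈-Reasoning

  ·-nonNeg : ∀ n → 0# ≤ x → 0# ≤ n · x
  ·-nonNeg zero    0≤x = ≤-refl
  ·-nonNeg (suc n) 0≤x = +-nonNeg 0≤x (·-nonNeg n 0≤x)

  ·-monoˡ-≤ : ∀ {m n} → 0# ≤ x → m ℕ.≤ n → m · x ≤ n · x
  ·-monoˡ-≤ {n = n} 0≤x z≤n   = ·-nonNeg n 0≤x
  ·-monoˡ-≤ 0≤x (s≤s m≤n) = +-mono-≤ ≤-refl (·-monoˡ-≤ 0≤x m≤n)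

  -- If `x ≤ 0#`, the other `n` summands only decrease the sum, so `suc n · x ≤ x`. This yields the
  -- sign of a quotient without that of an inverse.
  ·-cancel-nonNeg : ∀ n → 0# ≤ suc n · x → 0# ≤ x
  ·-cancel-nonNeg {x} n 0≤nx with total 0# x
  ... | inj₁ 0≤x = 0≤x
  ... | inj₂ x≤0 = ≤-trans 0≤nx (begin
    x + n · x  ≤⟨ +-mono-≤ ≤-refl (n·x≤0 n) ⟩
    x + 0#     ≈⟨ +-identityʳ x ⟩
    x          ∎)
    where
    open ≤-Reasoning
    n·x≤0 : ∀ n → n · x ≤ 0#
    n·x≤0 zero    = ≤-refl
    n·x≤0 (suc n) = ≤-respʳ-≈ (+-identityʳ 0#) (+-mono-≤ x≤0 (n·x≤0 n))

  fromℕ≉0 : ∀ n → fromℕ (suc n) ≉ 0#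
  fromℕ≉0 n eq = 0≉1 (antisym 0≤1 (begin
    1#             ≈⟨ +-identityʳ 1# ⟨
    1# + 0#        ≤⟨ +-mono-≤ ≤-refl (·-nonNeg n 0≤1) ⟩
    1# + fromℕ n   ≈⟨ eq ⟩
    0#             ∎))
    where open ≤-Reasoning

  n·[x/n]≈x : ∀ n x → suc n · (x / fromℕ (suc n)) ≈ x
  n·[x/n]≈x n x = begin
    suc n · (x * N ⁻¹)         ≈⟨ ×-congʳ (suc n) (*-identityˡ _) ⟨
    suc n · (1# * (x * N ⁻¹))  ≈⟨ ×-assoc-* (suc n) 1# _ ⟨
    N * (x * N ⁻¹)             ≈⟨ solve 3 (λ n x n⁻¹ → n :* (x :* n⁻¹) := n :* n⁻¹ :* x) refl N x (N ⁻¹) ⟩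
    N * N ⁻¹ * x               ≈⟨ *-congʳ (*-inverseʳ N (fromℕ≉0 n)) ⟩
    1# * x                     ≈⟨ *-identityˡ x ⟩
    x                          ∎
    where open ≈-Reasoning
          N = fromℕ (suc n)

  x/n-nonNeg : ∀ n → 0# ≤ x → 0# ≤ x / fromℕ (suc n)
  x/n-nonNeg {x} n 0≤x = ·-cancel-nonNeg n (≤-respʳ-≈ (sym (n·[x/n]≈x n x)) 0≤x)

  -- Absolute values.

  -1≤1 : - 1# ≤ 1#
  -1≤1 = ≤-from (+-nonNeg 0≤1 0≤1) (+-congˡ (-‿involutive 1#))

  x≤∣x∣ : ∀ x → x ≤ ∣ x ∣
  x≤∣x∣ x = x≤x⊔y x (- x)

  -x≤∣x∣ : ∀ x → - x ≤ ∣ x ∣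
  -x≤∣x∣ x = x≤y⊔x x (- x)

  ∣∣-lub : x ≤ b → - x ≤ b → ∣ x ∣ ≤ b
  ∣∣-lub = ⊔-lub

  ∣∣-cong : x ≈ y → ∣ x ∣ ≈ ∣ y ∣
  ∣∣-cong x≈y = ⊔-cong x≈y (-‿cong x≈y)

  0≤∣x∣ : ∀ x → 0# ≤ ∣ x ∣
  0≤∣x∣ x with total 0# x
  ... | inj₁ 0≤x = ≤-trans 0≤x (x≤∣x∣ x)
  ... | inj₂ x≤0 = ≤-trans (neg-nonNeg x≤0) (-x≤∣x∣ x)

  x≈0⇒∣x∣≈0 : x ≈ 0# → ∣ x ∣ ≈ 0#
  x≈0⇒∣x∣≈0 {x} x≈0 = antisym
    (∣∣-lub (≤-reflexive x≈0) (≤-reflexive (trans (-‿cong x≈0) -0#≈0#))) (0≤∣x∣ x)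

  ∣x∣≤0⇒x≈0 : ∣ x ∣ ≤ 0# → x ≈ 0#
  ∣x∣≤0⇒x≈0 {x} ∣x∣≤0 = antisym (≤-trans (x≤∣x∣ x) ∣x∣≤0)
    (≤-by (≤-trans (-x≤∣x∣ x) ∣x∣≤0) (solve 1 (λ x → x :- con 0ℤ := con 0ℤ :- :- x) refl x))

  x-y≈0⇒x≈y : x - y ≈ 0# → x ≈ y
  x-y≈0⇒x≈y {x} {y} x-y≈0 = begin
    x          ≈⟨ solve 2 (λ x y → x := x :- y :+ y) refl x y ⟩
    x - y + y  ≈⟨ +-congʳ x-y≈0 ⟩
    0# + y     ≈⟨ +-identityˡ y ⟩
    y          ∎
    where open ≈-Reasoning

  ∣x-x∣≈0 : ∀ x → ∣ x - x ∣ ≈ 0#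
  ∣x-x∣≈0 x = x≈0⇒∣x∣≈0 (-‿inverseʳ x)

  ∣x-y∣≤∣y-x∣ : ∀ x y → ∣ x - y ∣ ≤ ∣ y - x ∣
  ∣x-y∣≤∣y-x∣ x y = ∣∣-lub
    (≤-respˡ-≈ (solve 2 (λ x y → :- (y :- x) := x :- y) refl x y) (-x≤∣x∣ (y - x)))
    (≤-respˡ-≈ (solve 2 (λ x y → y :- x := :- (x :- y)) refl x y) (x≤∣x∣ (y - x)))

  ∣x-y∣≈∣y-x∣ : ∀ x y → ∣ x - y ∣ ≈ ∣ y - x ∣
  ∣x-y∣≈∣y-x∣ x y = antisym (∣x-y∣≤∣y-x∣ x y) (∣x-y∣≤∣y-x∣ y x)

  ∣x-z∣≤∣x-y∣+∣y-z∣ : ∀ x y z → ∣ x - z ∣ ≤ ∣ x - y ∣ + ∣ y - z ∣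
  ∣x-z∣≤∣x-y∣+∣y-z∣ x y z = ∣∣-lub
    (≤-respˡ-≈ (solve 3 (λ x y z → (x :- y) :+ (y :- z) := x :- z) refl x y z)
      (+-mono-≤ (x≤∣x∣ (x - y)) (x≤∣x∣ (y - z))))
    (≤-respˡ-≈ (solve 3 (λ x y z → :- (x :- y) :+ :- (y :- z) := :- (x :- z)) refl x y z)
      (+-mono-≤ (-x≤∣x∣ (x - y)) (-x≤∣x∣ (y - z))))

  ∣-x∣≤∣x∣ : ∀ x → ∣ - x ∣ ≤ ∣ x ∣
  ∣-x∣≤∣x∣ x = ∣∣-lub (-x≤∣x∣ x) (≤-respˡ-≈ (sym (-‿involutive x)) (x≤∣x∣ x))

  -- Since `∣ b ∣` is `b` or `- b`, the last two hypotheses give `∣ b ∣ * z ≤ 1#`, and `a` is at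
  -- most `∣ b ∣`.
  *-≤1-of-nonNeg : ∣ a ∣ ≤ ∣ b ∣ → 0# ≤ z → b * z ≤ 1# → - b * z ≤ 1# → a * z ≤ 1#
  *-≤1-of-nonNeg {a} {b} {z} a≤b 0≤z bz≤1 -bz≤1 =
    ≤-trans (*-monoʳ-≤ 0≤z (≤-trans (x≤∣x∣ a) a≤b)) ∣b∣z≤1
    where
    ∣b∣z≤1 : ∣ b ∣ * z ≤ 1#
    ∣b∣z≤1 with ⊔-sel b (- b)
    ... | inj₁ eq = ≤-respˡ-≈ (*-congʳ (sym eq)) bz≤1
    ... | inj₂ eq = ≤-respˡ-≈ (*-congʳ (sym eq)) -bz≤1

  -- The sign of `z` is unknown; when `z ≤ 0#`, the previous bound is applied to `- a` and `- z`.
  *-≤1 : ∣ a ∣ ≤ ∣ b ∣ → b * z ≈ 1# → a * z ≤ 1#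
  *-≤1 {a} {b} {z} a≤b bz≈1 = [ nonNeg , nonPos ]′ (total 0# z)
    where
    bz≤1 : b * z ≤ 1#
    bz≤1 = ≤-reflexive bz≈1
    -bz≤1 : - (b * z) ≤ 1#
    -bz≤1 = ≤-respˡ-≈ (-‿cong (sym bz≈1)) -1≤1
    nonNeg : 0# ≤ z → a * z ≤ 1#
    nonNeg 0≤z = *-≤1-of-nonNeg a≤b 0≤z bz≤1
      (≤-respˡ-≈ (solve 2 (λ b z → :- (b :* z) := :- b :* z) refl b z) -bz≤1)
    nonPos : z ≤ 0# → a * z ≤ 1#
    nonPos z≤0 = ≤-respˡ-≈ (solve 2 (λ a z → :- a :* :- z := a :* z) refl a z)
      (*-≤1-of-nonNeg (≤-trans (∣-x∣≤∣x∣ a) a≤b) (neg-nonNeg z≤0)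
        (≤-respˡ-≈ (solve 2 (λ b z → :- (b :* z) := b :* :- z) refl b z) -bz≤1)
        (≤-respˡ-≈ (solve 2 (λ b z → b :* z := :- b :* :- z) refl b z) bz≤1))

  -- With `z` the inverse of an entry `b` of largest modulus, this bounds all rescaled entries.
  ∣*∣≤1 : ∣ a ∣ ≤ ∣ b ∣ → b * z ≈ 1# → ∣ a * z ∣ ≤ 1#
  ∣*∣≤1 {a} {b} {z} a≤b bz≈1 = ∣∣-lub (*-≤1 a≤b bz≈1)
    (≤-respˡ-≈ (solve 2 (λ a z → :- a :* z := :- (a :* z)) refl a z)
      (*-≤1 (≤-trans (∣-x∣≤∣x∣ a) a≤b) bz≈1))

  minimum : (f : Vector Carrier (suc n)) → ∃ λ k → ∀ i → f k ≤ f i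
  minimum {n} f = argmin f zero (allFin (suc n)) ,
    λ i → All.lookup (f[argmin]≤f[xs] {f = f} zero (allFin (suc n))) (∈-allFin i)
    where open Data.List.Extrema totalOrder

  maximum : (f : Vector Carrier (suc n)) → ∃ λ k → ∀ i → f i ≤ f k
  maximum {n} f = argmax f zero (allFin (suc n)) ,
    λ i → All.lookup (f[xs]≤f[argmax] {f = f} zero (allFin (suc n))) (∈-allFin i)
    where open Data.List.Extrema totalOrder

  -- Dot products and homogeneous linear systems.

  infix 8 _∙_
  -- Binds tighter than `_*_`, so `x * u ∙ v` means `x * (u ∙ v)`.
  _∙_ : Vector Carrier n → Vector Carrier n → Carrier
  u ∙ v = sum λ i → u i * v i

  ∙-scaleˡ : ∀ (u v : Vector Carrier n) x → (λ i → x * u i) ∙ v ≈ x * u ∙ v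
  ∙-scaleˡ u v x = trans
    (sum-cong-≋ λ i → *-assoc x (u i) (v i))
    (sym (*-distribˡ-sum x (λ i → u i * v i)))

  ∙-scaleʳ : ∀ (u v : Vector Carrier n) x → u ∙ (λ i → x * v i) ≈ x * u ∙ v
  ∙-scaleʳ u v x = trans
    (sum-cong-≋ λ i → solve 3 (λ u v x → u :* (x :* v) := x :* u :* v) refl (u i) (v i) x)
    (∙-scaleˡ u v x)

  ∙-distribʳ-+ : ∀ (u v t : Vector Carrier n) → (λ i → u i + v i) ∙ t ≈ u ∙ t + v ∙ t
  ∙-distribʳ-+ u v t = trans
    (sum-cong-≋ λ i → solve 3 (λ u v t → (u :+ v) :* t := u :* t :+ v :* t) refl (u i) (v i) (t i))
    (∑-distrib-+ (λ i → u i * t i) (λ i → v i * t i))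

  ∙-distribʳ-- : ∀ (u v t : Vector Carrier n) → (λ i → u i - v i) ∙ t ≈ u ∙ t - v ∙ t
  ∙-distribʳ-- u v t = begin
    (λ i → u i - v i) ∙ t                      ≈⟨ ∙-distribʳ-+ u (λ i → - v i) t ⟩
    u ∙ t + (λ i → - v i) ∙ t                  ≈⟨ +-congˡ (sum-cong-≋ λ i → *-congʳ {t i} (-1*x≈-x (v i))) ⟨
    u ∙ t + (λ i → - 1# * v i) ∙ t             ≈⟨ +-congˡ (∙-scaleˡ v t (- 1#)) ⟩
    u ∙ t + - 1# * v ∙ t                       ≈⟨ +-congˡ (-1*x≈-x (v ∙ t)) ⟩
    u ∙ t - v ∙ t                              ∎
    where open ≈-Reasoning

  ∙-zeroʳ : (u : Vector Carrier n) → u ∙ (λ _ → 0#) ≈ 0#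
  ∙-zeroʳ {n} u = trans (sum-cong-≋ λ i → zeroʳ (u i)) (sum-replicate-zero n)

  -- By division-free elimination of the first unknown.
  kernel : (A : Vector (Vector Carrier (suc n)) n) →
           ∃ λ t → (∃ λ k → t k ≉ 0#) × (∀ j → A j ∙ t ≈ 0#)
  kernel {zero} A = (λ _ → 1#) , (zero , λ 1≈0 → 0≉1 (sym 1≈0)) , λ ()
  kernel {suc n} A with all? (λ j → A j zero ≟ 0#)
  -- The first unknown occurs in no equation, so the first unit vector is a solution.
  ... | yes column≈0 = e , (zero , λ 1≈0 → 0≉1 (sym 1≈0)) , A∙e≈0
    where
    e : Vector Carrier (suc (suc n))
    e = 1# ∷ᵛ λ _ → 0#
    A∙e≈0 : ∀ j → A j ∙ e ≈ 0#
    A∙e≈0 j = begin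
      A j zero * 1# + tail (A j) ∙ (λ _ → 0#)  ≈⟨ +-cong (*-congʳ (column≈0 j)) (∙-zeroʳ (tail (A j))) ⟩
      0# * 1# + 0#                             ≈⟨ +-identityʳ (0# * 1#) ⟩
      0# * 1#                                  ≈⟨ zeroˡ 1# ⟩
      0#                                       ∎
      where open ≈-Reasoning
  ... | no ¬column≈0 with ¬∀⟶∃¬ _ _ (λ j → A j zero ≟ 0#) ¬column≈0
  ...   | p , pivot≉0 = t , (suc (proj₁ s≉0) , *-nonZero pivot≉0 (proj₂ s≉0)) , A∙t≈0
    where
    pivot = A p zero
    row = λ j → A (punchIn p j)
    -- Each remaining row, times the pivot, minus the multiple of the pivot row that cancels its
    -- first coefficient.
    B : Vector (Vector Carrier (suc n)) n
    B j i = pivot * tail (row j) i - row j zero * tail (A p) i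
    s = proj₁ (kernel B)
    s≉0 = proj₁ (proj₂ (kernel B))
    t : Vector Carrier (suc (suc n))
    -- The other unknowns are scaled by `pivot`, so that the pivot equation gives the first one
    -- without division.
    t = - (tail (A p) ∙ s) ∷ᵛ λ i → pivot * s i
    A∙t : ∀ j → A j ∙ t ≈ A j zero * - (tail (A p) ∙ s) + pivot * tail (A j) ∙ s
    A∙t j = +-congˡ (∙-scaleʳ (tail (A j)) s pivot)
    open ≈-Reasoning
    row∙t≈0 : ∀ j → row j ∙ t ≈ 0#
    row∙t≈0 j = begin
      row j ∙ t ≈⟨ A∙t (punchIn p j) ⟩
      row j zero * - (tail (A p) ∙ s) + pivot * tail (row j) ∙ s
        ≈⟨ solve 4 (λ b u a v → b :* :- u :+ a :* v := a :* v :- b :* u) refl _ _ _ _ ⟩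
      pivot * tail (row j) ∙ s - row j zero * tail (A p) ∙ s
        ≈⟨ +-cong (∙-scaleˡ (tail (row j)) s pivot) (-‿cong (∙-scaleˡ (tail (A p)) s (row j zero))) ⟨
      (λ i → pivot * tail (row j) i) ∙ s - (λ i → row j zero * tail (A p) i) ∙ s
        ≈⟨ ∙-distribʳ-- (λ i → pivot * tail (row j) i) (λ i → row j zero * tail (A p) i) s ⟨
      B j ∙ s ≈⟨ proj₂ (proj₂ (kernel B)) j ⟩
      0# ∎
    A∙t≈0 : ∀ j → A j ∙ t ≈ 0#
    A∙t≈0 j with p Fin.≟ j
    ... | yes ≡.refl = trans (A∙t j) (solve 2 (λ a u → a :* :- u :+ a :* u := con 0ℤ) refl pivot _)
    ... | no p≢j     = ≡.subst (λ j → A j ∙ t ≈ 0#) (punchIn-punchOut p≢j) (row∙t≈0 (punchOut p≢j))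

  -- Dividing by the entry of largest modulus itself, rather than by its modulus, makes that entry
  -- exactly `1#` and not merely plus or minus one.
  normalisedKernel : (A : Vector (Vector Carrier (suc n)) n) →
    ∃ λ t → (∀ i → ∣ t i ∣ ≤ 1#) × (∃ λ k → t k ≈ 1#) × (∀ j → A j ∙ t ≈ 0#)
  normalisedKernel A =
    let t , (k , tk≉0) , A∙t≈0 = kernel A
        m , ∣t∣≤∣tm∣           = maximum (λ i → ∣ t i ∣)
        u                     = t m ⁻¹
        -- Were the entry of largest modulus zero, `t k` would vanish too.
        tm≉0 tm≈0             = tk≉0 (∣x∣≤0⇒x≈0 (≤-trans (∣t∣≤∣tm∣ k) (≤-reflexive (x≈0⇒∣x∣≈0 tm≈0))))
        tmu≈1                 = *-inverseʳ (t m) tm≉0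
    in (λ i → u * t i) ,
       (λ i → ≤-respˡ-≈ (∣∣-cong (*-comm (t i) u)) (∣*∣≤1 (∣t∣≤∣tm∣ i) tmu≈1)) ,
       (m , trans (*-comm u (t m)) tmu≈1) ,
       λ j → trans (∙-scaleʳ (A j) t u) (trans (*-congˡ (A∙t≈0 j)) (zeroʳ u))

-- Piecewise linear functions on equal segments.

module Segments {c ℓ₁ ℓ₂} (R : Reals c ℓ₁ ℓ₂)
  (ℓ : Reals.Carrier R) (0≤ℓ : Reals._≤_ R (Reals.0# R) ℓ) where

  open OrderedField R

  private variable
    x y : Carrier
    n : ℕ

  -- The length beyond the first segment. Shifting by `ℓ` turns the later segments into the initial
  -- ones, which allows recursion on their number.
  excess : Carrier → Carrier
  excess x = (x - ℓ) ⊔ 0#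

  -- For 0 ≤ x, the i-th entry is the length of [0, x] ∩ [i ℓ, (i + 1) ℓ].
  portion : Carrier → Vector Carrier n
  portion {suc n} x = x ⊓ ℓ ∷ᵛ portion (excess x)

  -- For 0 ≤ x, the integral over [0, x] of the step function with value t i
  -- on the i-th segment.
  ramp : Vector Carrier n → Carrier → Carrier
  ramp t x = portion x ∙ t

  excess-cong : x ≈ y → excess x ≈ excess y
  excess-cong x≈y = ⊔-cong (+-congʳ x≈y) refl

  excess-mono : x ≤ y → excess x ≤ excess y
  excess-mono x≤y = ⊔-monoˡ-≤ 0# (+-monoˡ-≤ (- ℓ) x≤y)

  excess-below : x ≤ ℓ → excess x ≈ 0#
  excess-below {x} x≤ℓ =
    x≤y⇒x⊔y≈y (≤-by x≤ℓ (solve 2 (λ x l → con 0ℤ :- (x :- l) := l :- x) refl x ℓ))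

  excess-above : 0# ≤ x → excess (ℓ + x) ≈ x
  excess-above {x} 0≤x = trans (excess≈ (≤-respʳ-≈ (sym eq) 0≤x)) eq
    where
    eq : ℓ + x - ℓ ≈ x
    eq = solve 2 (λ l x → l :+ x :- l := x) refl ℓ x
    excess≈ : 0# ≤ y → y ⊔ 0# ≈ y
    excess≈ = x≤y⇒y⊔x≈y

  ⊓ℓ-above : 0# ≤ x → (ℓ + x) ⊓ ℓ ≈ ℓ
  ⊓ℓ-above {x} 0≤x = x≤y⇒y⊓x≈x (≤-from 0≤x (solve 2 (λ l x → l :+ x :- l := x) refl ℓ x))

  ⊓+excess : ∀ x → x ⊓ ℓ + excess x ≈ x
  ⊓+excess x = [ below , above ]′ (total x ℓ)
    where
    below : x ≤ ℓ → x ⊓ ℓ + excess x ≈ x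
    below x≤ℓ = trans (+-cong (x≤y⇒x⊓y≈x x≤ℓ) (excess-below x≤ℓ)) (+-identityʳ x)
    above : ℓ ≤ x → x ⊓ ℓ + excess x ≈ x
    above ℓ≤x = trans (+-cong (x≤y⇒y⊓x≈x ℓ≤x) (x≤y⇒y⊔x≈y (≤⇒0≤- ℓ≤x)))
                  (solve 2 (λ l x → l :+ (x :- l) := x) refl ℓ x)

  ramp-cong : (t : Vector Carrier n) → x ≈ y → ramp t x ≈ ramp t y
  ramp-cong {zero}  t x≈y = refl
  ramp-cong {suc n} t x≈y =
    +-cong (*-congʳ (⊓-cong x≈y refl)) (ramp-cong (tail t) (excess-cong x≈y))

  -- The inductive step of `ramp-increment`: `a` is the length covered in the first segment, `s` the
  -- slope there, and `b` the change over the later segments.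
  ∣slope∣≤1 : ∀ {a b d s} → 0# ≤ a → ∣ s ∣ ≤ 1# → ∣ b ∣ ≤ d → ∣ a * s + b ∣ ≤ a + d
  ∣slope∣≤1 {a} {b} {d} {s} 0≤a ∣s∣≤1 ∣b∣≤d = ∣∣-lub
    (≤-from (+-nonNeg (*-nonNeg 0≤a (≤⇒0≤- (≤-trans (x≤∣x∣ s) ∣s∣≤1)))
                      (≤⇒0≤- (≤-trans (x≤∣x∣ b) ∣b∣≤d)))
      (solve 4 (λ a b d s → a :+ d :- (a :* s :+ b) := a :* (con 1ℤ :- s) :+ (d :- b)) refl a b d s))
    (≤-from (+-nonNeg (*-nonNeg 0≤a (≤⇒0≤- (≤-trans (-x≤∣x∣ s) ∣s∣≤1)))
                      (≤⇒0≤- (≤-trans (-x≤∣x∣ b) ∣b∣≤d)))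
      (solve 4 (λ a b d s → a :+ d :- :- (a :* s :+ b) := a :* (con 1ℤ :- :- s) :+ (d :- :- b)) refl a b d s))

  -- Both `x ⊓ ℓ` and `excess x` are monotone in `x` and add up to `x`, so `y - x` splits into
  -- nonnegative lengths inside the first segment and beyond it.
  ramp-increment : (t : Vector Carrier n) → (∀ i → ∣ t i ∣ ≤ 1#) → x ≤ y →
                   ∣ ramp t y - ramp t x ∣ ≤ y - x
  ramp-increment {zero} t ∣t∣≤1 x≤y = ∣∣-lub
    (≤-respˡ-≈ (sym (-‿inverseʳ 0#)) (≤⇒0≤- x≤y))
    (≤-respˡ-≈ (solve 0 (con 0ℤ := :- (con 0ℤ :- con 0ℤ)) refl) (≤⇒0≤- x≤y))
  ramp-increment {suc n} {x} {y} t ∣t∣≤1 x≤y = begin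
    ∣ ramp t y - ramp t x ∣
      ≈⟨ ∣∣-cong (solve 5 (λ m n s u v → n :* s :+ v :- (m :* s :+ u) := (n :- m) :* s :+ (v :- u)) refl
           (x ⊓ ℓ) (y ⊓ ℓ) (t zero) (ramp (tail t) (excess x)) (ramp (tail t) (excess y))) ⟩
    ∣ (y ⊓ ℓ - x ⊓ ℓ) * t zero + (ramp (tail t) (excess y) - ramp (tail t) (excess x)) ∣
      ≤⟨ ∣slope∣≤1 (≤⇒0≤- (⊓-monoˡ-≤ ℓ x≤y)) (∣t∣≤1 zero)
           (ramp-increment (tail t) (λ i → ∣t∣≤1 (suc i)) (excess-mono x≤y)) ⟩
    y ⊓ ℓ - x ⊓ ℓ + (excess y - excess x)
      ≈⟨ solve 4 (λ m n e f → n :- m :+ (f :- e) := n :+ f :- (m :+ e)) refl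
           (x ⊓ ℓ) (y ⊓ ℓ) (excess x) (excess y) ⟩
    y ⊓ ℓ + excess y - (x ⊓ ℓ + excess x)
      ≈⟨ +-cong (⊓+excess y) (-‿cong (⊓+excess x)) ⟩
    y - x ∎
    where open ≤-Reasoning

  -- The one-sided Lipschitz bound, in the additive form that is summed along a path by
  -- `potential-≤`.
  ramp-nonexpansive : (t : Vector Carrier n) → (∀ i → ∣ t i ∣ ≤ 1#) → ∀ x y →
                      ramp t x ≤ ∣ x - y ∣ + ramp t y
  ramp-nonexpansive t ∣t∣≤1 x y = ≤-by increment
    (solve 3 (λ d u v → d :+ v :- u := d :- (u :- v)) refl ∣ x - y ∣ (ramp t x) (ramp t y))
    where
    increment : ramp t x - ramp t y ≤ ∣ x - y ∣
    increment with total x y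
    ... | inj₂ y≤x = ≤-trans (x≤∣x∣ _) (≤-trans (ramp-increment t ∣t∣≤1 y≤x) (x≤∣x∣ (x - y)))
    ... | inj₁ x≤y = ≤-trans (x≤∣x∣ _) (≤-trans (∣x-y∣≤∣y-x∣ _ _)
                       (≤-trans (ramp-increment t ∣t∣≤1 x≤y)
                         (≤-trans (x≤∣x∣ (y - x)) (∣x-y∣≤∣y-x∣ y x))))

  ramp-segment : (t : Vector Carrier n) (k : Fin n) →
                 ramp t (suc (toℕ k) · ℓ) ≈ ℓ * t k + ramp t (toℕ k · ℓ)
  ramp-segment t zero = begin
    ((ℓ + 0#) ⊓ ℓ) * t zero + ramp (tail t) (excess (ℓ + 0#))
      ≈⟨ +-cong (*-congʳ (⊓ℓ-above ≤-refl)) (ramp-cong (tail t) (excess-above ≤-refl)) ⟩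
    ℓ * t zero + ramp (tail t) 0#
      ≈⟨ +-congˡ (+-identityˡ _) ⟨
    -- Read backwards: in `ramp t 0#` the first term vanishes because `0# ⊓ ℓ` is zero.
    ℓ * t zero + (0# + ramp (tail t) 0#)
      ≈⟨ +-congˡ (+-cong (trans (*-congʳ (x≤y⇒x⊓y≈x 0≤ℓ)) (zeroˡ (t zero))) (ramp-cong (tail t) (excess-below 0≤ℓ))) ⟨
    ℓ * t zero + ((0# ⊓ ℓ) * t zero + ramp (tail t) (excess 0#)) ∎
    where open ≈-Reasoning
  ramp-segment t (suc k) = begin
    ramp t (ℓ + (ℓ + kℓ))
      ≈⟨ ramp-above (+-nonNeg 0≤ℓ 0≤kℓ) ⟩
    ℓ * t zero + ramp (tail t) (ℓ + kℓ)
      ≈⟨ +-congˡ (ramp-segment (tail t) k) ⟩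
    ℓ * t zero + (ℓ * t (suc k) + ramp (tail t) kℓ)
      ≈⟨ solve 3 (λ a b c → a :+ (b :+ c) := b :+ (a :+ c)) refl _ _ _ ⟩
    ℓ * t (suc k) + (ℓ * t zero + ramp (tail t) kℓ)
      ≈⟨ +-congˡ (ramp-above 0≤kℓ) ⟨
    ℓ * t (suc k) + ramp t (ℓ + kℓ) ∎
    where
    open ≈-Reasoning
    kℓ = toℕ k · ℓ
    0≤kℓ = ·-nonNeg (toℕ k) 0≤ℓ
    ramp-above : 0# ≤ x → ramp t (ℓ + x) ≈ ℓ * t zero + ramp (tail t) x
    ramp-above 0≤x = +-cong (*-congʳ (⊓ℓ-above 0≤x)) (ramp-cong (tail t) (excess-above 0≤x))

  -- For fixed `x`, `ramp t x` is linear in `t` with coefficients `portion x`, so equality at `u j`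
  -- and `v j` is the equation whose row is the difference of their portions.
  compatibleRamp : (u v : Vector Carrier n) →
    ∃ λ (t : Vector Carrier (suc n)) →
      (∀ i → ∣ t i ∣ ≤ 1#) × (∃ λ k → t k ≈ 1#) × (∀ j → ramp t (u j) ≈ ramp t (v j))
  compatibleRamp {n} u v =
    let t , ∣t∣≤1 , tk≈1 , At≈0 = normalisedKernel λ j i → portion {suc n} (u j) i - portion (v j) i
    in t , ∣t∣≤1 , tk≈1 , λ j →
         x-y≈0⇒x≈y (trans (sym (∙-distribʳ-- (portion (u j)) (portion (v j)) t)) (At≈0 j))

  locate : ∀ n → 0# ≤ x → x ≤ suc n · ℓ →
           ∃ λ (k : Fin (suc n)) → toℕ k · ℓ ≤ x × x ≤ suc (toℕ k) · ℓ
  locate zero 0≤x x≤ℓ = zero , 0≤x , x≤ℓ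
  -- The comparison is with `1 · ℓ`, which is the upper end `suc (toℕ k) · ℓ` as it computes for
  -- `k = zero`.
  locate {x} (suc n) 0≤x x≤ with total x (1 · ℓ)
  ... | inj₁ x≤ℓ = zero , 0≤x , x≤ℓ
  ... | inj₂ ℓ≤x =
    let k , kℓ≤ , ≤kℓ = locate n 0≤x-ℓ x-ℓ≤
    in suc k , ≤-by kℓ≤ (solve 3 (λ x l m → x :- (l :+ m) := x :- l :- m) refl x ℓ _)
             , ≤-by ≤kℓ (solve 3 (λ x l m → l :+ m :- x := m :- (x :- l)) refl x ℓ _)
    where
    0≤x-ℓ : 0# ≤ x - ℓ
    0≤x-ℓ = ≤-by ℓ≤x (solve 2 (λ x l → x :- l :- con 0ℤ := x :- (l :+ con 0ℤ)) refl x ℓ)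
    x-ℓ≤ : x - ℓ ≤ suc n · ℓ
    x-ℓ≤ = ≤-by x≤ (solve 3 (λ x l m → m :- (x :- l) := l :+ m :- x) refl x ℓ _)

-- Coordinates on the path and lower bounds for path lengths.

module PathWithWormholes {c ℓ₁ ℓ₂} (R : Reals c ℓ₁ ℓ₂)
  (L : Reals.Carrier R) (0<L : Reals._<_ R (Reals.0# R) L) where

  open OrderedField R
  open MetricGraphs R

  G : MetricGraph
  G = pathGraph L 0<L

  private variable
    x y z : Point G
    w : ℕ

  coord : Point G → Carrier
  coord (vertex zero)       = 0#
  coord (vertex (suc zero)) = L
  coord (interior _ t _ _)  = t

  at-coord : ∀ x → At G zero x (coord x)
  at-coord (vertex zero)               = source-at
  at-coord (vertex (suc zero))         = target-at
  at-coord (interior zero t 0<t t<L)   = interior-at t 0<t t<L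

  -- The edge is not a loop, so a point has a single coordinate. Propositional equality allows
  -- `along` steps to be treated by matching on `≡.refl`.
  at⇒≡coord : ∀ {e s} → At G e x s → s ≡ coord x
  at⇒≡coord source-at           = ≡.refl
  at⇒≡coord target-at           = ≡.refl
  at⇒≡coord (interior-at _ _ _) = ≡.refl

  0≤coord : ∀ x → 0# ≤ coord x
  0≤coord (vertex zero)             = ≤-refl
  0≤coord (vertex (suc zero))       = proj₁ 0<L
  0≤coord (interior _ _ (0≤t , _) _) = 0≤t

  coord≤L : ∀ x → coord x ≤ L
  coord≤L (vertex zero)              = proj₁ 0<L
  coord≤L (vertex (suc zero))        = ≤-refl
  coord≤L (interior _ _ _ (t≤L , _)) = t≤L

  -- Interior points require strict inequalities, so a value equal to `0#` or `L` goes to a vertex;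
  -- hence the coordinate is `t` only up to `≈`.
  point : ∀ {t} → 0# ≤ t → t ≤ L → ∃ λ x → coord x ≈ t
  point {t} 0≤t t≤L with 0# ≟ t | t ≟ L
  ... | yes 0≈t | _       = vertex zero , 0≈t
  ... | no _    | yes t≈L = vertex (suc zero) , sym t≈L
  ... | no 0≉t  | no t≉L  = interior zero t (0≤t , 0≉t) (t≤L , t≉L) , refl

  segment : (W : Vector (Wormhole G) w) → ∀ x y → Step G W x y ∣ coord x - coord y ∣
  segment W x y = along zero (at-coord x) (at-coord y)

  -- A 1-Lipschitz function with equal values at the ends of each wormhole changes along a path by
  -- at most its length. Both halves of the theorem use this: with a ramp for the lower bound, with
  -- the distance to a fixed point for sharpness.
  potential-≤ : (W : Vector (Wormhole G) w) (f : Point G → Carrier) →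
                (∀ x y → f x ≤ ∣ coord x - coord y ∣ + f y) →
                (∀ i → f (proj₁ (W i)) ≈ f (proj₂ (W i))) →
                ∀ {ℓ} → Path G W x y ℓ → f x ≤ ℓ + f y
  potential-≤ {x = x} {y} W f nonexpansive compatible = bound
    where
    step : ∀ {x y ℓ} → Step G W x y ℓ → f x ≤ ℓ + f y
    step {x} {y} (along e x-at y-at) with at⇒≡coord x-at | at⇒≡coord y-at
    ... | ≡.refl | ≡.refl = nonexpansive x y
    step (forward i)  = ≤-reflexive (trans (compatible i) (sym (+-identityˡ _)))
    step (backward i) = ≤-reflexive (trans (sym (compatible i)) (sym (+-identityˡ _)))

    bound : ∀ {x y ℓ} → Path G W x y ℓ → f x ≤ ℓ + f y
    bound []      = ≤-reflexive (sym (+-identityˡ _))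
    bound {x} {y} (_∷_ {y = z} {a = a} {b} s p) = begin
      f x             ≤⟨ step s ⟩
      a + f z         ≤⟨ +-mono-≤ ≤-refl (bound p) ⟩
      a + (b + f y)   ≈⟨ solve 3 (λ a b v → a :+ (b :+ v) := a :+ b :+ v) refl a b (f y) ⟩
      a + b + f y     ∎
      where open ≤-Reasoning

  -- The lower bound on the diameter.

  module EqualSegments (w : ℕ) where

    ℓ : Carrier
    ℓ = L / fromℕ (suc w)

    0≤ℓ : 0# ≤ ℓ
    0≤ℓ = x/n-nonNeg w (proj₁ 0<L)

    [1+w]ℓ≈L : suc w · ℓ ≈ L
    [1+w]ℓ≈L = n·[x/n]≈x w L

    ·ℓ≤L : ∀ {m} → m ℕ.≤ suc w → m · ℓ ≤ L
    ·ℓ≤L m≤1+w = ≤-respʳ-≈ [1+w]ℓ≈L (·-monoˡ-≤ 0≤ℓ m≤1+w)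

    open Segments R ℓ 0≤ℓ

    -- Slope `1#` on segment `k` makes the ramp rise by exactly `ℓ` from `y` to `x`.
    segment-≤ : (W : Vector (Wormhole G) w) (t : Vector Carrier (suc w)) →
                (∀ i → ∣ t i ∣ ≤ 1#) →
                (∀ j → ramp t (coord (proj₁ (W j))) ≈ ramp t (coord (proj₂ (W j)))) →
                ∀ {k a} → t k ≈ 1# → coord x ≈ suc (toℕ k) · ℓ → coord y ≈ toℕ k · ℓ →
                Path G W x y a → ℓ ≤ a
    segment-≤ {x} {y} W t ∣t∣≤1 compatible {k} {a} tk≈1 x≈ y≈ p =
      ≤-by (potential-≤ W f (λ u v → ramp-nonexpansive t ∣t∣≤1 (coord u) (coord v)) compatible p) (begin
        a - ℓ                    ≈⟨ solve 3 (λ a l v → a :- l := a :+ v :- (l :+ v)) refl a ℓ (f y) ⟩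
        a + f y - (ℓ + f y)      ≈⟨ +-congˡ (-‿cong fx≈) ⟨
        a + f y - f x            ∎)
      where
      open ≈-Reasoning
      f : Point G → Carrier
      f u = ramp t (coord u)
      fx≈ : f x ≈ ℓ + f y
      fx≈ = begin
        f x                             ≈⟨ ramp-cong t x≈ ⟩
        ramp t (suc (toℕ k) · ℓ)        ≈⟨ ramp-segment t k ⟩
        ℓ * t k + ramp t (toℕ k · ℓ)    ≈⟨ +-cong (*-congˡ tk≈1) (ramp-cong t (sym y≈)) ⟩
        ℓ * 1# + f y                    ≈⟨ +-congʳ (*-identityʳ ℓ) ⟩
        ℓ + f y                         ∎

    diameter-≥ : (W : Vector (Wormhole G) w) (D : Carrier) → IsDiameter G W D → ℓ ≤ D
    diameter-≥ W D (distance , _) =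
      let t , ∣t∣≤1 , (k , tk≈1) , compatible =
            compatibleRamp (λ j → coord (proj₁ (W j))) (λ j → coord (proj₂ (W j)))
          x , x≈ = point (·-nonNeg (suc (toℕ k)) 0≤ℓ) (·ℓ≤L (toℕ<n k))
          y , y≈ = point (·-nonNeg (toℕ k) 0≤ℓ) (·ℓ≤L (ℕ.<⇒≤ (toℕ<n k)))
          -- Some path realises the distance `d`, so it suffices to bound the length of that path.
          d , ((a , p , a≈d) , _) , d≤D = distance x y
      in ≤-trans (segment-≤ W t ∣t∣≤1 compatible tk≈1 x≈ y≈ p) (≤-trans (≤-reflexive a≈d) d≤D)

    -- Sharpness: distances after identifying the midpoints.

    r : Carrier
    r = ℓ / fromℕ 2

    0≤r : 0# ≤ r
    0≤r = x/n-nonNeg 1 0≤ℓ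

    r+r≈ℓ : r + r ≈ ℓ
    r+r≈ℓ = trans (+-congˡ (sym (+-identityʳ r))) (n·[x/n]≈x 1 ℓ)

    abstract
      midpoint : ∀ (k : Fin (suc w)) → ∃ λ x → coord x ≈ toℕ k · ℓ + r
      midpoint k = point (+-nonNeg (·-nonNeg (toℕ k) 0≤ℓ) 0≤r) (begin
        toℕ k · ℓ + r    ≤⟨ +-mono-≤ ≤-refl (≤-from 0≤r (trans (+-congʳ (sym r+r≈ℓ)) (solve 1 (λ r → r :+ r :- r := r) refl r))) ⟩
        toℕ k · ℓ + ℓ    ≈⟨ +-comm _ ℓ ⟩
        suc (toℕ k) · ℓ  ≤⟨ ·ℓ≤L (toℕ<n k) ⟩
        L                ∎)
        where open ≤-Reasoning

    hub : Fin (suc w) → Point G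
    hub k = proj₁ (midpoint k)

    -- A star centred at `hub zero`: its `w` pairs identify all `w + 1` midpoints.
    hubs : Vector (Wormhole G) w
    hubs i = hub zero , hub (suc i)

    abstract
      nearest : ∀ x → ∃ λ k → ∀ i → ∣ x - coord (hub k) ∣ ≤ ∣ x - coord (hub i) ∣
      nearest x = minimum λ k → ∣ x - coord (hub k) ∣

    -- The distance to the common point of the midpoints, as `dist-hub` and `dist-isDistance`
    -- confirm.
    height : Carrier → Carrier
    height x = ∣ x - coord (hub (proj₁ (nearest x))) ∣

    height≤ : ∀ x k → height x ≤ ∣ x - coord (hub k) ∣
    height≤ x = proj₂ (nearest x)

    0≤height : ∀ x → 0# ≤ height x
    0≤height x = 0≤∣x∣ _

    height-nonexpansive : ∀ x y → height x ≤ ∣ x - y ∣ + height y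
    height-nonexpansive x y = ≤-trans (height≤ x (proj₁ (nearest y))) (∣x-z∣≤∣x-y∣+∣y-z∣ x y _)

    height-hub : ∀ k → height (coord (hub k)) ≤ 0#
    height-hub k = ≤-trans (height≤ _ k) (≤-reflexive (∣x-x∣≈0 (coord (hub k))))

    -- The midpoint of the segment containing `x` is a candidate for the nearest one.
    height≤r : ∀ x → height (coord x) ≤ r
    height≤r x = ≤-trans (height≤ (coord x) k) (∣∣-lub
      (≤-by x≤ (begin
        r - (coord x - coord (hub k))   ≈⟨ +-congˡ (-‿cong x-hub≈) ⟩
        r - (coord x - (kℓ + r))        ≈⟨ solve 3 (λ x r m → r :- (x :- (m :+ r)) := r :+ r :+ m :- x) refl (coord x) r kℓ ⟩
        r + r + kℓ - coord x            ≈⟨ +-congʳ (+-congʳ r+r≈ℓ) ⟩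
        ℓ + kℓ - coord x                ∎))
      (≤-by ≤x (begin
        r - - (coord x - coord (hub k)) ≈⟨ +-congˡ (-‿cong (-‿cong x-hub≈)) ⟩
        r - - (coord x - (kℓ + r))      ≈⟨ solve 3 (λ x r m → r :- :- (x :- (m :+ r)) := x :- m) refl (coord x) r kℓ ⟩
        coord x - kℓ                    ∎)))
      where
      open ≈-Reasoning
      located = locate w (0≤coord x) (≤-respʳ-≈ (sym [1+w]ℓ≈L) (coord≤L x))
      k = proj₁ located
      kℓ = toℕ k · ℓ
      ≤x = proj₁ (proj₂ located)
      x≤ = proj₂ (proj₂ located)
      x-hub≈ : coord x - coord (hub k) ≈ coord x - (kℓ + r)
      x-hub≈ = +-congˡ (-‿cong (proj₂ (midpoint k)))

    r≤∣0-hub∣ : ∀ k → r ≤ ∣ 0# - coord (hub k) ∣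
    r≤∣0-hub∣ k = begin
      r                         ≤⟨ ≤-from (·-nonNeg (toℕ k) 0≤ℓ) (solve 2 (λ m r → m :+ r :- r := m) refl (toℕ k · ℓ) r) ⟩
      toℕ k · ℓ + r             ≈⟨ proj₂ (midpoint k) ⟨
      coord (hub k)             ≈⟨ solve 1 (λ p → :- (con 0ℤ :- p) := p) refl (coord (hub k)) ⟨
      - (0# - coord (hub k))    ≤⟨ -x≤∣x∣ (0# - coord (hub k)) ⟩
      ∣ 0# - coord (hub k) ∣    ∎
      where open ≤-Reasoning

    r≤∣L-hub∣ : ∀ k → r ≤ ∣ L - coord (hub k) ∣
    r≤∣L-hub∣ k = begin
      r                                    ≈⟨ solve 2 (λ m r → r :+ r :+ m :- (m :+ r) := r) refl (toℕ k · ℓ) r ⟨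
      r + r + toℕ k · ℓ - (toℕ k · ℓ + r)  ≈⟨ +-cong (+-congʳ r+r≈ℓ) (-‿cong (sym (proj₂ (midpoint k)))) ⟩
      suc (toℕ k) · ℓ - coord (hub k)      ≤⟨ +-monoˡ-≤ (- coord (hub k)) (·ℓ≤L (toℕ<n k)) ⟩
      L - coord (hub k)                    ≤⟨ x≤∣x∣ (L - coord (hub k)) ⟩
      ∣ L - coord (hub k) ∣                ∎
      where open ≤-Reasoning

    -- Closed form for the distance with the wormholes added: either straight along the path or
    -- through the common point.
    dist : Carrier → Carrier → Carrier
    dist x y = ∣ x - y ∣ ⊓ (height x + height y)

    dist≤∣-∣ : ∀ x y → dist x y ≤ ∣ x - y ∣
    dist≤∣-∣ x y = x⊓y≤x ∣ x - y ∣ (height x + height y)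

    dist≤height+height : ∀ x y → dist x y ≤ height x + height y
    dist≤height+height x y = x⊓y≤y ∣ x - y ∣ (height x + height y)

    dist-sel : ∀ x y → dist x y ≈ ∣ x - y ∣ ⊎ dist x y ≈ height x + height y
    dist-sel x y = ⊓-sel ∣ x - y ∣ (height x + height y)

    dist-nonexpansive : ∀ x y z → dist x z ≤ ∣ x - y ∣ + dist y z
    dist-nonexpansive x y z = [ directly , via-hubs ]′ (dist-sel y z)
      where
      open ≤-Reasoning
      directly : dist y z ≈ ∣ y - z ∣ → dist x z ≤ ∣ x - y ∣ + dist y z
      directly eq = begin
        dist x z                             ≤⟨ dist≤∣-∣ x z ⟩
        ∣ x - z ∣                            ≤⟨ ∣x-z∣≤∣x-y∣+∣y-z∣ x y z ⟩
        ∣ x - y ∣ + ∣ y - z ∣                ≈⟨ +-congˡ eq ⟨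
        ∣ x - y ∣ + dist y z                 ∎
      via-hubs : dist y z ≈ height y + height z → dist x z ≤ ∣ x - y ∣ + dist y z
      via-hubs eq = begin
        dist x z                             ≤⟨ dist≤height+height x z ⟩
        height x + height z                  ≤⟨ +-mono-≤ (height-nonexpansive x y) ≤-refl ⟩
        ∣ x - y ∣ + height y + height z      ≈⟨ solve 3 (λ a b c → a :+ b :+ c := a :+ (b :+ c)) refl ∣ x - y ∣ (height y) (height z) ⟩
        ∣ x - y ∣ + (height y + height z)    ≈⟨ +-congˡ eq ⟨
        ∣ x - y ∣ + dist y z                 ∎

    -- The value does not depend on `k`, so the distance to a fixed point agrees at the two ends of
    -- every wormhole, as `potential-≤` requires.
    dist-hub : ∀ k z → dist (coord (hub k)) z ≈ height z
    dist-hub k z = antisym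
      (begin
        dist p z               ≤⟨ dist≤height+height p z ⟩
        height p + height z    ≤⟨ +-mono-≤ (height-hub k) ≤-refl ⟩
        0# + height z          ≈⟨ +-identityˡ (height z) ⟩
        height z               ∎)
      (⊓-glb {height z} {∣ p - z ∣} {height p + height z} (≤-trans (height≤ z k) (∣x-y∣≤∣y-x∣ z p))
        (begin
          height z             ≈⟨ +-identityˡ (height z) ⟨
          0# + height z        ≤⟨ +-mono-≤ (0≤height p) ≤-refl ⟩
          height p + height z  ∎))
      where
      open ≤-Reasoning
      p = coord (hub k)

    -- At most one wormhole step separates a hub from the centre of the star; the step adds `0#`, so
    -- lengths agree only up to `≈`.
    to-centre : ∀ k {z a} → Path G hubs (hub zero) z a → ∃ λ b → Path G hubs (hub k) z b × b ≈ a
    to-centre zero    p = _ , p , refl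
    to-centre (suc i) p = _ , backward i ∷ p , +-identityˡ _

    from-centre : ∀ k {z a} → Path G hubs (hub k) z a → ∃ λ b → Path G hubs (hub zero) z b × b ≈ a
    from-centre zero    p = _ , p , refl
    from-centre (suc i) p = _ , forward i ∷ p , +-identityˡ _

    via-centre : ∀ x y k m → ∃ λ a →
      Path G hubs x y a × a ≈ ∣ coord x - coord (hub k) ∣ + ∣ coord y - coord (hub m) ∣
    via-centre x y k m =
      let b , p , b≈   = from-centre m (segment hubs (hub m) y ∷ [])
          c , q , c≈b  = to-centre k p
      in ∣ coord x - coord (hub k) ∣ + c , segment hubs x (hub k) ∷ q ,
         -- The last step runs from `hub m` to `y`, so its coordinate difference has to be reversed.
         +-congˡ (trans c≈b (trans b≈ (trans (+-identityʳ _) (∣x-y∣≈∣y-x∣ (coord (hub m)) (coord y)))))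

    shortest-path : ∀ x y → ∃ λ a → Path G hubs x y a × a ≈ dist (coord x) (coord y)
    shortest-path x y = [ directly , via-hubs ]′ (dist-sel (coord x) (coord y))
      where
      directly : dist (coord x) (coord y) ≈ ∣ coord x - coord y ∣ →
                 ∃ λ a → Path G hubs x y a × a ≈ dist (coord x) (coord y)
      directly eq = _ , segment hubs x y ∷ [] , trans (+-identityʳ ∣ coord x - coord y ∣) (sym eq)
      via-hubs : dist (coord x) (coord y) ≈ height (coord x) + height (coord y) →
                 ∃ λ a → Path G hubs x y a × a ≈ dist (coord x) (coord y)
      via-hubs eq =
        let a , p , a≈ = via-centre x y (proj₁ (nearest (coord x))) (proj₁ (nearest (coord y)))
        in a , p , trans a≈ (sym eq)

    -- For the lower bound the potential is the distance to `y` itself, which is at most zero at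
    -- `y`.
    dist-isDistance : ∀ x y → IsDistance G hubs x y (dist (coord x) (coord y))
    dist-isDistance x y = shortest-path x y , λ a p → begin
      dist (coord x) (coord y)      ≤⟨ potential-≤ hubs (λ u → dist (coord u) (coord y))
                                         (λ u v → dist-nonexpansive (coord u) (coord v) (coord y)) compatible p ⟩
      a + dist (coord y) (coord y)  ≤⟨ +-mono-≤ ≤-refl (dist≤∣-∣ (coord y) (coord y)) ⟩
      a + ∣ coord y - coord y ∣     ≈⟨ +-congˡ (∣x-x∣≈0 (coord y)) ⟩
      a + 0#                        ≈⟨ +-identityʳ a ⟩
      a                             ∎
      where
      open ≤-Reasoning
      compatible : ∀ i → dist (coord (hub zero)) (coord y) ≈ dist (coord (hub (suc i))) (coord y)
      compatible i = trans (dist-hub zero (coord y)) (sym (dist-hub (suc i) (coord y)))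

    dist≤ℓ : ∀ x y → dist (coord x) (coord y) ≤ ℓ
    dist≤ℓ x y = begin
      dist (coord x) (coord y)             ≤⟨ dist≤height+height (coord x) (coord y) ⟩
      height (coord x) + height (coord y)  ≤⟨ +-mono-≤ (height≤r x) (height≤r y) ⟩
      r + r                                ≈⟨ r+r≈ℓ ⟩
      ℓ                                    ∎
      where open ≤-Reasoning

    -- Both routes have length at least `ℓ`: the straight one has length `L`, and each end is at
    -- least `r` from every midpoint.
    dist-ends : dist 0# L ≈ ℓ
    dist-ends = antisym (dist≤ℓ (vertex zero) (vertex (suc zero))) (⊓-glb
      (begin
        ℓ            ≈⟨ +-identityʳ ℓ ⟨
        1 · ℓ        ≤⟨ ·ℓ≤L (s≤s z≤n) ⟩
        L            ≈⟨ solve 1 (λ L → :- (con 0ℤ :- L) := L) refl L ⟨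
        - (0# - L)   ≤⟨ -x≤∣x∣ (0# - L) ⟩
        ∣ 0# - L ∣   ∎)
      (≤-respˡ-≈ r+r≈ℓ (+-mono-≤ (r≤∣0-hub∣ (proj₁ (nearest 0#))) (r≤∣L-hub∣ (proj₁ (nearest L))))))
      where open ≤-Reasoning

    isDistance-resp-≈ : ∀ {W : Vector (Wormhole G) w} {x y d e} → d ≈ e → IsDistance G W x y d → IsDistance G W x y e
    isDistance-resp-≈ d≈e ((a , p , a≈d) , d≤) =
      (a , p , trans a≈d d≈e) , λ b q → ≤-respˡ-≈ d≈e (d≤ b q)

    hubs-diameter : IsDiameter G hubs ℓ
    hubs-diameter =
      (λ x y → dist (coord x) (coord y) , dist-isDistance x y , dist≤ℓ x y) ,
      vertex zero , vertex (suc zero) , isDistance-resp-≈ dist-ends (dist-isDistance (vertex zero) (vertex (suc zero)))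

mainTheorem9 :
  ∀ {c ℓ₁ ℓ₂} (R : Reals c ℓ₁ ℓ₂) →
  let open Reals R
      open MetricGraphs R
  in
  (L : Carrier) (0<L : 0# < L) (w : ℕ) →
  let G = pathGraph L 0<L in
  ((W : Vector (Wormhole G) w) (D : Carrier) → IsDiameter G W D → L / fromℕ (suc w) ≤ D)
  ×
  (∃ λ (W : Vector (Wormhole G) w) → IsDiameter G W (L / fromℕ (suc w)))
mainTheorem9 R L 0<L w = diameter-≥ , hubs , hubs-diameter
  where
  open PathWithWormholes R L 0<L
  open EqualSegments w
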